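{- Let $t, r$ be two positive integers and let $G$ be a graph of treewidth at most $t$. Then $\mathrm{pc}_r(G,k)\in O\big(t^{O(t)}\, r^{t+1}\, k\big)$. That is, there exist absolute constants $C,c>0$ such that for all positive integers $t,r$, every graph $G$ of treewidth at most $t$ and every integer $k$ with $1\le k\le |V(G)|$, one has $\mathrm{pc}_r(G,k)\le C\, t^{ct}\, r^{t+1}\, k$.
   Context: All graphs are finite, simple, loopless and undirected. $\mathrm{dist}(u,v)$ is the usual graph distance (number of edges of a shortest path, $+\infty$ if there is none). For an integer $r$, let $\mathrm{Cap}_r(\ell)=\ell$ if $\ell\le r$ and $\mathrm{Cap}_r(\ell)=+\infty$ otherwise. For $A\subseteq V(G)$ and $v\in V(G)$, the $r$-profile of $v$ with respect to $A$ is the function $p_r(v,A):A\to\mathbb N\cup\{+\infty\}$, $a\mapsto \mathrm{Cap}_r(\mathrm{dist}(a,v))$. Let $\mathrm{pc}_r(G,A)=\big|\{p_r(v,A): v\in V(G)\}\setminus\{a\mapsto+\infty\}\big|$ (the number of distinct $r$-profiles with respect to $A$, not counting the constant $+\infty$ profile), and let $\mathrm{pc}_r(G,k)=\max\{\mathrm{pc}_r(G,A): A\subseteq V(G), |A|=k\}$ (the $r$-profile complexity of $G$). -}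

module Defs where

open import Data.Empty using (⊥-elim)
open import Data.Fin using (Fin)
open import Data.Fin.Properties using (_≟_; all?; any?)
open import Data.Fin.Subset using (Subset; inside; outside; _∈_; ∣_∣)
open import Data.Fin.Subset.Properties using (_∈?_)
open import Data.List using (List; []; _∷_; _++_; map; filter; deduplicate; length; allFin)
open import Data.List.Extrema.Nat using (max)
open import Data.List.Relation.Unary.All using (All)
open import Data.List.Relation.Unary.Unique.Propositional using (Unique)
open import Data.List.Relation.Unary.Unique.DecPropositional using (unique?)
open import Data.Maybe using () renaming (map to map⁺)
open import Data.Nat using (ℕ; zero; suc; _∸_; _≤_; _≤?_)
import Data.Nat.Properties as ℕ
open import Data.Product using (Σ; ∃; ∃-syntax; _×_; _,_)
open import Data.Vec using ([]; _∷_)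
open import Data.Vec.Properties.WithK using ([]=-irrelevant)
open import Function using (_∘_)
open import Level using (0ℓ)
open import Relation.Binary using (Rel; Decidable; Symmetric)
open import Relation.Binary.Construct.Closure.ReflexiveTransitive using (Star; ε; _◅_)
open import Relation.Binary.PropositionalEquality using (_≡_; _≗_; refl; cong; subst)
open import Relation.Nullary using (¬_; Dec; yes; no; ¬?)
open import Relation.Nullary.Construct.Add.Supremum using (_⁺; ⊤⁺; [_]; ≡-dec)
open import Relation.Nullary.Decidable using (map′)
import Relation.Unary as U

-- Decidability of adjacency is automatic classically; constructively it is
-- what makes distances computable.

record Graph (n : ℕ) : Set₁ where
  field
    Adj        : Rel (Fin n) 0ℓ
    adj?       : Decidable Adj
    adj-sym    : Symmetric Adj
    adj-irrefl : ∀ {u} → ¬ Adj u u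

open Graph public

module _ {n : ℕ} (G : Graph n) where

  Walk : Rel (Fin n) 0ℓ
  Walk = Star (Adj G)

  vertices : ∀ {u v} → Walk u v → List (Fin n)
  vertices {u} ε       = u ∷ []
  vertices {u} (_ ◅ w) = u ∷ vertices w

  walkLength : ∀ {u v} → Walk u v → ℕ
  walkLength ε       = 0
  walkLength (_ ◅ w) = suc (walkLength w)

  IsPath : ∀ {u v} → Walk u v → Set
  IsPath w = Unique (vertices w)

  PathOfLength : Fin n → Fin n → ℕ → Set
  PathOfLength u v ℓ = Σ (Walk u v) λ w → IsPath w × walkLength w ≡ ℓ

  walkWith? : ∀ {P : List (Fin n) → Set} → U.Decidable P → ∀ u v ℓ →
              Dec (Σ (Walk u v) λ w → P (vertices w) × walkLength w ≡ ℓ)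
  walkWith? P? u v zero with u ≟ v
  ... | no u≢v   = no λ { (ε , _) → u≢v refl ; (_ ◅ _ , _ , ()) }
  ... | yes refl = map′ (λ p → ε , p , refl)
                        (λ { (ε , p , _) → p ; (_ ◅ _ , _ , ()) })
                        (P? (u ∷ []))
  walkWith? {P} P? u v (suc ℓ) =
    map′ (λ { (_ , e , w , p , eq) → e ◅ w , p , cong suc eq })
         (λ { (ε , _ , ()) ; (e ◅ w , p , eq) → _ , e , w , p , ℕ.suc-injective eq })
         (any? step?)
    where
    step? : ∀ x → Dec (Adj G u x × Σ (Walk x v) λ w → P (u ∷ vertices w) × walkLength w ≡ ℓ)
    step? x with adj? G u x
    ... | no ¬e = no λ { (e , _) → ¬e e }
    ... | yes e = map′ (e ,_) (λ { (_ , r) → r }) (walkWith? (P? ∘ (u ∷_)) x v ℓ)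

  pathOfLength? : ∀ u v ℓ → Dec (PathOfLength u v ℓ)
  pathOfLength? = walkWith? (unique? _≟_)

-- Least ℓ < b satisfying P, or ⊤⁺ if there is none.

least : ∀ {P : ℕ → Set} → U.Decidable P → ℕ → ℕ ⁺
least P? zero    = ⊤⁺
least P? (suc b) with P? 0
... | yes _ = [ 0 ]
... | no  _ = map⁺ suc (least (P? ∘ suc) b)

-- A path visits at most n vertices, so its length is below n and the bounded
-- search misses nothing.

dist : ∀ {n} → Graph n → Fin n → Fin n → ℕ ⁺
dist {n} G u v = least (pathOfLength? G u v) n

Cap : ℕ → ℕ ⁺ → ℕ ⁺
Cap r ⊤⁺ = ⊤⁺
Cap r [ ℓ ] with ℓ ≤? r
... | yes _ = [ ℓ ]
... | no  _ = ⊤⁺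

Profile : ∀ {n} → Subset n → Set
Profile A = ∃ (_∈ A) → ℕ ⁺

profile : ∀ {n} → Graph n → ℕ → Fin n → (A : Subset n) → Profile A
profile G r v A (a , _) = Cap r (dist G a v)

infinite : ∀ {n} {A : Subset n} → Profile A
infinite _ = ⊤⁺

-- Profiles are compared pointwise, which is equality of functions.

_≗?_ : ∀ {n} {A : Subset n} → Decidable (_≗_ {A = ∃ (_∈ A)} {B = ℕ ⁺})
_≗?_ {A = A} p q =
  map′ (λ eq (a , a∈A) → eq a a∈A) (λ eq a a∈A → eq (a , a∈A)) (all? agree?)
  where
  agree? : ∀ a → Dec ((a∈A : a ∈ A) → p (a , a∈A) ≡ q (a , a∈A))
  agree? a with a ∈? A
  ... | no a∉A  = yes (⊥-elim ∘ a∉A)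
  ... | yes a∈A =
    map′ (λ eq a∈A′ → subst (λ m → p (a , m) ≡ q (a , m)) ([]=-irrelevant a∈A a∈A′) eq)
         (λ eq → eq a∈A)
         (≡-dec ℕ._≟_ (p (a , a∈A)) (q (a , a∈A)))

profiles : ∀ {n} → Graph n → ℕ → (A : Subset n) → List (Profile A)
profiles {n} G r A = deduplicate _≗?_ (map (λ v → profile G r v A) (allFin n))

profileCount : ∀ {n} → Graph n → ℕ → Subset n → ℕ
profileCount G r A = length (filter (λ p → ¬? (p ≗? infinite)) (profiles G r A))

subsets : ∀ n → List (Subset n)
subsets zero    = [] ∷ []
subsets (suc n) = map (inside ∷_) (subsets n) ++ map (outside ∷_) (subsets n)

subsetsOfSize : ∀ n → ℕ → List (Subset n)
subsetsOfSize n k = filter (λ A → ∣ A ∣ ℕ.≟ k) (subsets n)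

-- The base value 0 matters only when k > n, where no set of size k exists.

profileComplexity : ∀ {n} → Graph n → ℕ → ℕ → ℕ
profileComplexity {n} G r k = max 0 (map (profileCount G r) (subsetsOfSize n k))

Connected : ∀ {n} → Graph n → Set
Connected G = ∀ u v → Walk G u v

-- A cycle is a path with at least two edges whose ends are adjacent.

Cyclic : ∀ {n} → Graph n → Set
Cyclic G = ∃[ u ] ∃[ v ] Σ (Walk G u v) λ w →
           IsPath G w × 2 ≤ walkLength G w × Adj G v u

record IsTree {m : ℕ} (T : Graph m) : Set where
  field
    nonempty  : 1 ≤ m
    connected : Connected T
    acyclic   : ¬ Cyclic T

InducesConnected : ∀ {n} → Graph n → (Fin n → Set) → Set
InducesConnected G P = ∀ u v → P u → P v → Σ (Walk G u v) λ w → All P (vertices G w)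

record TreeDecomposition {n : ℕ} (G : Graph n) : Set₁ where
  field
    size            : ℕ
    tree            : Graph size
    isTree          : IsTree tree
    bag             : Fin size → Subset n
    coversVertices  : ∀ v → ∃[ i ] v ∈ bag i
    coversEdges     : ∀ {u v} → Adj G u v → ∃[ i ] (u ∈ bag i × v ∈ bag i)
    inducesSubtrees : ∀ v → InducesConnected tree (λ i → v ∈ bag i)

  width : ℕ
  width = max 0 (map (λ i → ∣ bag i ∣) (allFin size)) ∸ 1

-- Treewidth is the least width of a tree decomposition.

TreewidthAtMost : ∀ {n} → ℕ → Graph n → Set₁
TreewidthAtMost t G = ∃ λ (D : TreeDecomposition G) → TreeDecomposition.width D ≤ t

{-# OPTIONS --safe #-}

-- In a tree decomposition, prune leaves of the tree while remembering which
-- nodes matter: this gives at most |A| + 1 unions of three bags such that every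
-- vertex v has one, say S, meeting all walks from A to v. The r-profile of v on
-- A is then determined by its r-profile on S, that is, by the tests
-- dist (s , v) ≤ ρ with s ∈ S and ρ ≤ r. These are O(t r) tests, and by
-- Sauer–Shelah they have O(t r)^(t+1) traces once no t+2 of them are shattered.
-- Were t+2 balls shattered, then the cells formed by the vertices lying deepest
-- in each of these balls would be connected and pairwise touching (a complete
-- minor), so by the Helly property of subtrees some bag would meet all of
-- them and have at least t+2 elements.

module Submission where

open import Data.Bool using (Bool; true; false)
import Data.Bool.Properties as Bool
open import Data.Empty using (⊥-elim)
open import Data.Fin as Fin using (Fin; zero; suc)
open import Data.Fin.Properties as Fin using (_≟_; all?; any?; injective⇒≤; ¬∀⟶∃¬)
open import Data.Fin.Subset as Subset using (Subset; inside; outside; ∣_∣; _-_)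
open import Data.Fin.Subset.Properties using (_∈?_; x∈p∧x≢y⇒x∈p-y; x∈p⇒∣p-x∣<∣p∣)
open import Data.List using (List; []; _∷_; _++_; [_]; length; lookup; map; concatMap; filter; upTo; allFin; deduplicate)
open import Data.List.Extrema.Nat using (max≤v⁺; xs≤max)
open import Data.List.Membership.DecPropositional using () renaming (_∈?_ to mem?)
open import Data.List.Membership.Propositional using (_∈_; _∉_; lose; find)
open import Data.List.Membership.Propositional.Properties
  using (∈-lookup; ∈-map⁺; ∈-filter⁻; ∈-++⁻; ∈-concatMap⁺; ∈-upTo⁺; ∈-allFin)
open import Data.List.Properties using (length-++; length-map; length-upTo; length-filter)
open import Data.List.Relation.Binary.Sublist.Propositional as Sublist using ()
import Data.List.Relation.Binary.Sublist.Propositional.Properties as Sublist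
open import Data.List.Relation.Binary.Subset.Propositional using (_⊆_)
open import Data.List.Relation.Binary.Subset.Propositional.Properties using (Any-resp-⊆)
open import Data.List.Relation.Unary.All as All using (All; []; _∷_)
open import Data.List.Relation.Unary.All.Properties as All using (anti-mono; ¬Any⇒All¬; all-filter)
open import Data.List.Relation.Unary.AllPairs using (AllPairs; []; _∷_)
import Data.List.Relation.Unary.AllPairs.Properties as AllPairs
open import Data.List.Relation.Unary.Any as Any using (Any; here; there)
open import Data.List.Relation.Unary.Any.Properties using (map⁺)
open import Data.List.Relation.Unary.Unique.Propositional using (Unique)
open import Data.Maybe using (Maybe; just; nothing)
open import Data.Maybe.Properties using (just-injective)
open import Data.Maybe.Relation.Unary.Any using (just) renaming (Any to AnyMaybe)
open import Data.Nat using (ℕ; zero; suc; _+_; _*_; _^_; _∸_; _≤_; _<_; z≤n; s≤s; _≤?_; s≤s⁻¹)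
open import Data.Nat.Properties renaming (_≟_ to _≟ℕ_)
open import Data.Nat.Solver using (module +-*-Solver)
open import Data.Product using (Σ; ∃; ∃-syntax; _×_; _,_; proj₁; proj₂)
open import Data.Sum as Sum using (_⊎_; inj₁; inj₂)
open import Data.Vec using ([]; _∷_; here; there)
open import Function using (_∘_; id; const)
open import Relation.Binary using (tri<; tri≈; tri>) renaming (Decidable to Decidable₂)
open import Relation.Binary.Construct.Closure.ReflexiveTransitive using (ε; _◅_; _◅◅_)
open import Relation.Binary.PropositionalEquality using (_≡_; _≢_; _≗_; refl; sym; trans; cong; subst)
open import Relation.Nullary using (¬_; Dec; yes; no; ¬?; contradiction)
open import Relation.Nullary.Decidable using (does; dec-true; dec-false; _×-dec_; _⊎-dec_)
import Relation.Unary as U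
open import Defs

-- Walks, loop erasure and distance

lookup-injective : ∀ {A : Set} {xs : List A} → Unique xs → ∀ i j → lookup xs i ≡ lookup xs j → i ≡ j
lookup-injective (_ ∷ _)    zero    zero    _  = refl
lookup-injective (x∉ ∷ _)   zero    (suc j) eq = contradiction eq (All.lookup x∉ (∈-lookup j))
lookup-injective (x∉ ∷ _)   (suc i) zero    eq = contradiction (sym eq) (All.lookup x∉ (∈-lookup i))
lookup-injective (_ ∷ xs!)  (suc i) (suc j) eq = cong suc (lookup-injective xs! i j eq)

unique⇒length≤ : ∀ {n} {xs : List (Fin n)} → Unique xs → length xs ≤ n
unique⇒length≤ xs! = injective⇒≤ (lookup-injective xs! _ _)

module _ {n} (G : Graph n) where

  WalkIn : (Fin n → Set) → Fin n → Fin n → Set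
  WalkIn P u v = Σ (Walk G u v) λ w → All P (vertices G w)

  length-vertices : ∀ {u v} (w : Walk G u v) → length (vertices G w) ≡ suc (walkLength G w)
  length-vertices ε       = refl
  length-vertices (_ ◅ w) = cong suc (length-vertices w)

  start∈ : ∀ {u v} (w : Walk G u v) → u ∈ vertices G w
  start∈ ε       = here refl
  start∈ (_ ◅ _) = here refl

  end∈ : ∀ {u v} (w : Walk G u v) → v ∈ vertices G w
  end∈ ε       = here refl
  end∈ (_ ◅ w) = there (end∈ w)

  walkIn-trans : ∀ {P u v x} → WalkIn P u v → WalkIn P v x → WalkIn P u x
  walkIn-trans (ε , _)           w = w
  walkIn-trans (e ◅ w₁ , p ∷ ps) w =
    let w′ , ps′ = walkIn-trans (w₁ , ps) w in e ◅ w′ , p ∷ ps′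

  walkIn-sym : ∀ {P u v} → WalkIn P u v → WalkIn P v u
  walkIn-sym (ε , ps)         = ε , ps
  walkIn-sym (e ◅ w , p ∷ ps) =
    walkIn-trans (walkIn-sym (w , ps))
      (adj-sym G e ◅ ε , All.lookup ps (start∈ w) ∷ p ∷ [])

  walkIn-map : ∀ {P Q u v} → (∀ {x} → P x → Q x) → WalkIn P u v → WalkIn Q u v
  walkIn-map f (w , ps) = w , All.map f ps

  walkLength-◅◅ : ∀ {u v x} (w : Walk G u v) (w′ : Walk G v x) →
                  walkLength G (w ◅◅ w′) ≡ walkLength G w + walkLength G w′
  walkLength-◅◅ ε       w′ = refl
  walkLength-◅◅ (_ ◅ w) w′ = cong suc (walkLength-◅◅ w w′)

  reverseWalk : ∀ {u v} (w : Walk G u v) → Σ (Walk G v u) λ w′ → walkLength G w′ ≡ walkLength G w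
  reverseWalk ε       = ε , refl
  reverseWalk (e ◅ w) =
    let w′ , eq = reverseWalk w in
    w′ ◅◅ (adj-sym G e ◅ ε) ,
    trans (walkLength-◅◅ w′ _) (trans (cong (_+ 1) eq) (+-comm (walkLength G w) 1))

  splitAt : ∀ {u v x} (w : Walk G u v) → x ∈ vertices G w →
            Σ (Walk G u x) λ w₁ → Σ (Walk G x v) λ w₂ →
            walkLength G w₁ + walkLength G w₂ ≡ walkLength G w
  splitAt ε       (here refl) = ε , ε , refl
  splitAt (e ◅ w) (here refl) = ε , e ◅ w , refl
  splitAt (e ◅ w) (there x∈w) =
    let w₁ , w₂ , eq = splitAt w x∈w in e ◅ w₁ , w₂ , cong suc eq

  PathWithin : ∀ {u v} → Walk G u v → Fin n → Set
  PathWithin {_} {v} w x = Σ (Walk G x v) λ w′ →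
    IsPath G w′ × walkLength G w′ ≤ walkLength G w × vertices G w′ ⊆ vertices G w

  suffix : ∀ {u v x} (w : Walk G u v) → IsPath G w → x ∈ vertices G w → PathWithin w x
  suffix ε       p       (here refl) = ε , p , ≤-refl , id
  suffix (e ◅ w) p       (here refl) = e ◅ w , p , ≤-refl , id
  suffix (e ◅ w) (_ ∷ p) (there x∈w) =
    let w′ , p′ , le , sub = suffix w p x∈w in w′ , p′ , m≤n⇒m≤1+n le , there ∘ sub

  -- After the tail is made a path, either `u` is not on it and can be put in front, or `u` is on it
  -- and the suffix from there already is the path. The length bound serves `walk⇒dist`, the
  -- inclusion of vertices serves `neighbour-unique`.
  eraseLoops : ∀ {u v} (w : Walk G u v) → PathWithin w u
  eraseLoops ε = ε , [] ∷ [] , z≤n , id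
  eraseLoops {u} (e ◅ w) with eraseLoops w
  ... | w′ , p , le , sub with mem? _≟_ u (vertices G w′)
  ...   | yes u∈w′ =
    let w″ , p″ , le″ , sub″ = suffix w′ p u∈w′ in
    w″ , p″ , m≤n⇒m≤1+n (≤-trans le″ le) , there ∘ sub ∘ sub″
  ...   | no u∉w′  =
    e ◅ w′ , ¬Any⇒All¬ _ u∉w′ ∷ p , s≤s le ,
    λ { (here eq) → here eq ; (there x∈) → there (sub x∈) }

  path-short : ∀ {u v} (w : Walk G u v) → IsPath G w → walkLength G w < n
  path-short w p = subst (_≤ n) (length-vertices w) (unique⇒length≤ p)

-- The order `d ≤ ℓ` on extended distances: `nothing` is +∞ and lies within no `ℓ`.
Within : ℕ → Maybe ℕ → Set
Within ℓ = AnyMaybe (_≤ ℓ)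

least-sound : ∀ {P : ℕ → Set} (P? : U.Decidable P) b {ℓ} → least P? b ≡ just ℓ → P ℓ
least-sound P? (suc b) eq with P? 0
least-sound P? (suc b) refl | yes p = p
least-sound P? (suc b) eq   | no _ with least (P? ∘ suc) b in eq′
least-sound P? (suc b) refl | no _ | just _ = least-sound (P? ∘ suc) b eq′

least-complete : ∀ {P : ℕ → Set} (P? : U.Decidable P) b {ℓ} → P ℓ → ℓ < b → Within ℓ (least P? b)
least-complete P? (suc b) {ℓ} p ℓ<b with P? 0
... | yes _ = just z≤n
least-complete P? (suc b) {zero}  p ℓ<b | no ¬p = contradiction p ¬p
least-complete P? (suc b) {suc ℓ} p (s≤s ℓ<b) | no ¬p
  with least (P? ∘ suc) b | least-complete (P? ∘ suc) b p ℓ<b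
... | just _ | just le = just (s≤s le)

module _ {n} (G : Graph n) where

  walk⇒dist : ∀ {u v ℓ} (w : Walk G u v) → walkLength G w ≤ ℓ → Within ℓ (dist G u v)
  walk⇒dist {u} {v} w w≤ℓ
    with w′ , p , le , _ ← eraseLoops G w
    with dist G u v | least-complete (pathOfLength? G u v) n (w′ , p , refl) (path-short G w′ p)
  ... | just _ | just d≤ = just (≤-trans d≤ (≤-trans le w≤ℓ))

  dist⇒walk : ∀ {u v ℓ} → Within ℓ (dist G u v) → Σ (Walk G u v) λ w → walkLength G w ≤ ℓ
  dist⇒walk {u} {v} d≤ℓ with dist G u v in eq
  dist⇒walk {u} {v} (just d≤ℓ) | just _ with least-sound (pathOfLength? G u v) n eq
  ... | w , _ , refl = w , d≤ℓ

-- Trees as leaf orders, and the Helly property of subtrees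

module _ {m} (T : Graph m) where

  -- The newest node comes first, so recursion removes a leaf.

  data LeafOrder : List (Fin m) → Set where
    root : ∀ x → LeafOrder [ x ]
    leaf : ∀ {P i p} → LeafOrder P → i ∉ P → p ∈ P → Adj T i p →
           (∀ {q} → q ∈ P → Adj T i q → q ≡ p) → LeafOrder (i ∷ P)

  leafOrder-unique : ∀ {P} → LeafOrder P → Unique P
  leafOrder-unique (root x)           = [] ∷ []
  leafOrder-unique (leaf o i∉P _ _ _) = ¬Any⇒All¬ _ i∉P ∷ leafOrder-unique o

  leafOrder-connected : ∀ {P u v} → LeafOrder P → u ∈ P → v ∈ P → WalkIn T (_∈ P) u v
  leafOrder-connected (root x) (here refl) (here refl) = ε , here refl ∷ []
  leafOrder-connected (leaf o _ _ _ _) (here refl) (here refl) = ε , here refl ∷ []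
  leafOrder-connected (leaf o _ p∈P e _) (here refl) (there v∈P) =
    let w , ws = leafOrder-connected o p∈P v∈P in e ◅ w , here refl ∷ All.map there ws
  leafOrder-connected (leaf o _ p∈P e _) (there u∈P) (here refl) =
    let w , ws = leafOrder-connected o p∈P u∈P in
    walkIn-sym T (e ◅ w , here refl ∷ All.map there ws)
  leafOrder-connected (leaf o _ _ _ _) (there u∈P) (there v∈P) =
    walkIn-map T there (leafOrder-connected o u∈P v∈P)

  crossing : ∀ {P u v} → Walk T u v → u ∈ P → v ∉ P → ∃[ p ] ∃[ i ] (p ∈ P × i ∉ P × Adj T i p)
  crossing ε u∈P v∉P = contradiction u∈P v∉P
  crossing {P} {u} (_◅_ {j = x} e w) u∈P v∉P with mem? _≟_ x P
  ... | yes x∈P = crossing w x∈P v∉P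
  ... | no  x∉P = u , x , u∈P , x∉P , adj-sym T e

  leafOrder-nonempty : ∀ {P} → LeafOrder P → ∃[ x ] x ∈ P
  leafOrder-nonempty (root x)         = x , here refl
  leafOrder-nonempty (leaf _ _ _ _ _) = _ , here refl

  module _ (tree : IsTree T) where
    open IsTree tree

    -- Two neighbours q ≠ p of i inside a subtree avoiding i would close a cycle.

    neighbour-unique : ∀ {P i p q} → LeafOrder P → i ∉ P → p ∈ P → Adj T i p →
                       q ∈ P → Adj T i q → q ≡ p
    neighbour-unique {P} {i} {p} {q} o i∉P p∈P ip q∈P iq
      with w , w⊆P ← leafOrder-connected o p∈P q∈P
      with eraseLoops T w
    ... | ε , _ = refl
    ... | w′@(_ ◅ _) , path , _ , sub =
      ⊥-elim (acyclic (i , q , ip ◅ w′ ,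
        All.tabulate (λ { x∈w′ refl → i∉P (All.lookup w⊆P (sub x∈w′)) }) ∷ path ,
        s≤s (s≤s z≤n) , adj-sym T iq))

    -- Connectedness gives an edge leaving `P`, whose outer end becomes the next leaf. The number
    -- `f` of missing nodes drives the recursion; when it is 0, one more leaf would make a
    -- repetition-free list longer than `m`.
    grow : ∀ f {P} → LeafOrder P → length P + f ≡ m → ∃[ P′ ] (LeafOrder P′ × ∀ x → x ∈ P′)
    grow f {P} o eq with all? (λ x → mem? _≟_ x P)
    ... | yes all = P , o , all
    ... | no ¬all
      with y , y∉P ← ¬∀⟶∃¬ m _ (λ x → mem? _≟_ x P) ¬all
      with x , x∈P ← leafOrder-nonempty o
      with p , i , p∈P , i∉P , ip ← crossing (connected x y) x∈P y∉P
      with f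
    ...   | suc f = grow f (leaf o i∉P p∈P ip (neighbour-unique o i∉P p∈P ip))
                      (trans (sym (+-suc (length P) f)) eq)
    ...   | zero  = ⊥-elim (1+n≰n (≤-trans (unique⇒length≤ (¬Any⇒All¬ P i∉P ∷ leafOrder-unique o))
                      (≤-reflexive (trans (sym eq) (+-identityʳ _)))))

    leafOrder : ∃[ P ] (LeafOrder P × ∀ x → x ∈ P)
    leafOrder = start nonempty refl
      where
      start : ∀ {k} → 1 ≤ k → k ≡ m → ∃[ P ] (LeafOrder P × ∀ x → x ∈ P)
      start (s≤s {n = k} _) refl = grow k (root zero) refl

  -- The graph of the retraction that moves the leaf `i` to its neighbour `p` and fixes every other
  -- node.
  Retracts : Fin m → Fin m → Fin m → Fin m → Set
  Retracts i p j j′ = (j ≡ i × j′ ≡ p) ⊎ (j ≢ i × j′ ≡ j)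

  -- Every visit to the leaf `i` is entered and left through `p`, so it can be cut out. One end has
  -- to differ from `i`: the constant walk at `i` retracts to `p`, which it does not visit, so the
  -- final inclusion would fail.
  contract : ∀ {P i p j k j′ k′} → p ∈ P → (∀ {q} → q ∈ P → Adj T i q → q ≡ p) →
             (w : Walk T j k) → All (_∈ i ∷ P) (vertices T w) →
             Retracts i p j j′ → Retracts i p k k′ → j ≢ i ⊎ k ≢ i →
             Σ (Walk T j′ k′) λ w′ → All (_∈ P) (vertices T w′) × vertices T w′ ⊆ vertices T w
  contract p∈P nb ε ws (inj₁ (refl , _)) _ (inj₁ j≢i) = contradiction refl j≢i
  contract p∈P nb ε ws (inj₁ (refl , _)) _ (inj₂ j≢i) = contradiction refl j≢i
  contract p∈P nb ε ws (inj₂ (j≢i , _)) (inj₁ (refl , _)) _ = contradiction refl j≢i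
  contract p∈P nb ε (here j≡i ∷ []) (inj₂ (j≢i , refl)) (inj₂ (_ , refl)) _ = contradiction j≡i j≢i
  contract p∈P nb ε (there j∈P ∷ []) (inj₂ (j≢i , refl)) (inj₂ (_ , refl)) _ = ε , j∈P ∷ [] , id
  contract p∈P nb (e ◅ w) (_ ∷ ws) (inj₁ (refl , _)) k↦ (inj₁ j≢i) = contradiction refl j≢i
  contract p∈P nb (e ◅ w) (_ ∷ ws) (inj₁ (refl , refl)) k↦ (inj₂ k≢i)
    with All.lookup ws (start∈ T w)
  ... | here refl  = contradiction e (adj-irrefl T)
  ... | there x∈P with refl ← nb x∈P e =
    let w′ , ws′ , sub = contract p∈P nb w ws (inj₂ ((λ { refl → adj-irrefl T e }) , refl)) k↦ (inj₂ k≢i)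
    in w′ , ws′ , there ∘ sub
  contract p∈P nb (e ◅ w) (here j≡i ∷ ws) (inj₂ (j≢i , refl)) k↦ _ = contradiction j≡i j≢i
  contract {i = i} p∈P nb (_◅_ {j = x} e w) (there j∈P ∷ ws) (inj₂ (j≢i , refl)) k↦ _ with x ≟ i
  ... | no x≢i =
    let w′ , ws′ , sub = contract p∈P nb w ws (inj₂ (x≢i , refl)) k↦ (inj₁ x≢i)
    in e ◅ w′ , j∈P ∷ ws′ , λ { (here eq) → here eq ; (there y∈) → there (sub y∈) }
  -- The walk enters `i` from `p`. If its end is `i`, the retracted walk stops at `p`; otherwise it
  -- goes on from the visit to `i`, which retracts to `p` again.
  ... | yes refl with refl ← nb j∈P (adj-sym T e) with k↦
  ...   | inj₁ (refl , refl) = ε , p∈P ∷ [] , λ { (here eq) → here eq }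
  ...   | inj₂ (k≢i , refl)  =
    let w′ , ws′ , sub = contract p∈P nb w ws (inj₁ (refl , refl)) k↦ (inj₂ k≢i)
    in w′ , ws′ , there ∘ sub

  ∉⇒≢ : ∀ {P : List (Fin m)} {i j} → i ∉ P → j ∈ P → j ≢ i
  ∉⇒≢ i∉P j∈P refl = i∉P j∈P

  -- Induction on the leaf order. If some `Q l` misses the leaf `i`, then each `Q k` containing `i`
  -- meets `Q l` at another node and, being connected, contains the neighbour `p`. So pairwise
  -- intersections and connectedness survive the removal of `i`. The case `k = l` of the meeting
  -- hypothesis says that no `Q k` is empty.
  helly : ∀ {P d} → LeafOrder P → (Q : Fin (suc d) → Fin m → Set) → (∀ k → U.Decidable (Q k)) →
          (∀ k {u v} → u ∈ P → v ∈ P → Q k u → Q k v → WalkIn T (λ x → x ∈ P × Q k x) u v) →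
          (∀ k l → ∃[ x ] (x ∈ P × Q k x × Q l x)) → ∃[ x ] (∀ k → Q k x)
  helly (root x) Q Q? conn meet = x , at-root
    where
    at-root : ∀ k → Q k x
    at-root k with meet k k
    ... | _ , here refl , q , _ = q
  helly {i ∷ P} (leaf {p = p} o i∉P p∈P ip nb) Q Q? conn meet with all? (λ k → Q? k i)
  ... | yes all = i , all
  ... | no ¬all with l , ¬ql ← ¬∀⟶∃¬ _ _ (λ k → Q? k i) ¬all = helly o Q Q? conn′ meet′
    where
    restrict : ∀ k {u v u′ v′} → WalkIn T (λ x → x ∈ i ∷ P × Q k x) u v →
               Retracts i p u u′ → Retracts i p v v′ → u ≢ i ⊎ v ≢ i →
               WalkIn T (λ x → x ∈ P × Q k x) u′ v′
    restrict k (w , ws) u↦ v↦ ne =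
      let w′ , ws′ , sub = contract p∈P nb w (All.map proj₁ ws) u↦ v↦ ne
      in w′ , All.zip (ws′ , anti-mono sub (All.map proj₂ ws))
    keep : ∀ {u} → u ∈ P → Retracts i p u u
    keep u∈P = inj₂ (∉⇒≢ i∉P u∈P , refl)
    conn′ : ∀ k {u v} → u ∈ P → v ∈ P → Q k u → Q k v → WalkIn T (λ x → x ∈ P × Q k x) u v
    conn′ k u∈P v∈P qu qv =
      restrict k (conn k (there u∈P) (there v∈P) qu qv) (keep u∈P) (keep v∈P) (inj₁ (∉⇒≢ i∉P u∈P))
    at-parent : ∀ k → Q k i → Q k p
    at-parent k qi with meet k l
    ... | y , here refl , _ , ql = contradiction ql ¬ql
    ... | y , there y∈P , qy , _ =
      let w , ws = restrict k (conn k (here refl) (there y∈P) qi qy)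
                     (inj₁ (refl , refl)) (keep y∈P) (inj₂ (∉⇒≢ i∉P y∈P))
      in proj₂ (All.lookup ws (start∈ T w))
    meet′ : ∀ k l → ∃[ x ] (x ∈ P × Q k x × Q l x)
    meet′ k k′ with meet k k′
    ... | x , there x∈P , q , q′ = x , x∈P , q , q′
    ... | x , here refl , q , q′ = p , p∈P , at-parent k q , at-parent k′ q′

-- Separating every node of a tree from a set of marked nodes

Marking : ℕ → Set
Marking m = Fin m → Maybe (Fin m)

update : ∀ {m} → Fin m → Fin m → Marking m → Marking m
update p y st x with x ≟ p
... | yes _ = just y
... | no  _ = st x

update-same : ∀ {m} (p y : Fin m) st → update p y st p ≡ just y
update-same p y st with p ≟ p
... | yes _  = refl
... | no p≢p = contradiction refl p≢p

update-other : ∀ {m} {p x : Fin m} y st → x ≢ p → update p y st x ≡ st x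
update-other {p = p} {x} y st x≢p with x ≟ p
... | yes x≡p = contradiction x≡p x≢p
... | no _    = refl

weight : ∀ {A : Set} → Maybe A → ℕ
weight nothing  = 0
weight (just _) = 1

count : ∀ {m} → Marking m → List (Fin m) → ℕ
count st []       = 0
count st (x ∷ xs) = weight (st x) + count st xs

count-≤ : ∀ {m} {st st′ : Marking m} xs → All (λ x → weight (st′ x) ≤ weight (st x)) xs →
          count st′ xs ≤ count st xs
count-≤ []       []         = z≤n
count-≤ (x ∷ xs) (le ∷ les) = +-mono-≤ le (count-≤ xs les)

weight≤1 : ∀ {A : Set} (x : Maybe A) → weight x ≤ 1
weight≤1 nothing  = z≤n
weight≤1 (just _) = ≤-refl

count-update : ∀ {m} {p y : Fin m} st xs → Unique xs → count (update p y st) xs ≤ suc (count st xs)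
count-update st [] [] = z≤n
count-update {p = p} {y} st (x ∷ xs) (x∉xs ∷ xs!) with x ≟ p
... | yes refl = s≤s (≤-trans
        (count-≤ xs (All.map (λ x≢z → ≤-reflexive (cong weight (update-other y st (x≢z ∘ sym)))) x∉xs))
        (m≤n+m _ (weight (st x))))
... | no _     = ≤-trans (+-monoʳ-≤ (weight (st x)) (count-update st xs xs!))
                         (≤-reflexive (+-suc (weight (st x)) _))

count-update-just : ∀ {m} {p y z : Fin m} st xs → st p ≡ just z →
                    count (update p y st) xs ≤ count st xs
count-update-just {p = p} {y} st xs eq = count-≤ xs (All.universal le xs)
  where
  le : ∀ x → weight (update p y st x) ≤ weight (st x)
  le x with x ≟ p
  ... | yes refl rewrite eq = ≤-refl
  ... | no  _    = ≤-refl

-- Before any pruning a marked node stands for itself and is its own gate.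
mark : ∀ {m} → List (Fin m) → Marking m
mark []       = const nothing
mark (x ∷ xs) = update x x (mark xs)

mark-∈ : ∀ {m} {x : Fin m} {xs} → x ∈ xs → mark xs x ≡ just x
mark-∈ {xs = y ∷ xs} (here refl) = update-same y y (mark xs)
mark-∈ {x = x} {y ∷ xs} (there x∈xs) with x ≟ y
... | yes refl = refl
... | no _     = mark-∈ x∈xs

count-mark : ∀ {m} {P : List (Fin m)} xs → Unique P → count (mark xs) P ≤ length xs
count-mark {P = P} [] P! = none P
  where
  none : ∀ P → count (const nothing) P ≤ 0
  none []      = z≤n
  none (x ∷ P) = none P
count-mark {P = P} (x ∷ xs) P! = ≤-trans (count-update (mark xs) P P!) (s≤s (count-mark xs P!))

module _ {m} (T : Graph m) where

  Separates : List (Fin m) → List (Fin m) → Fin m → Fin m → Set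
  Separates P X k j = (w : Walk T k j) → All (_∈ P) (vertices T w) → Any (_∈ X) (vertices T w)

  -- A mark y at k stands for marked nodes already pruned: they hang below k and
  -- are reached from k only through y.

  Screens : List (Fin m) → Marking m → List (Fin m) → Fin m → Set
  Screens P st X j = ∀ {k y} → k ∈ P → st k ≡ just y → y ∈ X ⊎ (k ≢ j × Separates P X k j)

  -- A walk using the leaf contracts to a walk on `P` through a subset of its nodes, so a hit of `X`
  -- on the latter is a hit on the former.
  separates-leaf : ∀ {P i p X k j k′ j′} → p ∈ P → (∀ {q} → q ∈ P → Adj T i q → q ≡ p) →
                   Retracts T i p k k′ → Retracts T i p j j′ → k ≢ i ⊎ j ≢ i →
                   Separates P X k′ j′ → Separates (i ∷ P) X k j
  separates-leaf p∈P nb k↦ j↦ ne sep w w⊆P =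
    let w′ , w′⊆P , sub = contract T p∈P nb w w⊆P k↦ j↦ ne
    in Any-resp-⊆ sub (sep w′ w′⊆P)

  -- Prune the leaf `i` with neighbour `p`. An unmarked leaf is dropped. If only `i` is marked, its
  -- mark moves to `p` with the same gate `y`, and the number of marks does not grow. If both are
  -- marked, one new set serves `i` and `p`, and a single mark at `p` with gate `p` replaces the
  -- two: the lost mark pays for the new set. The extra 1 pays for the set at the root.
  separators : ∀ {P} → LeafOrder T P → ∀ st → ∃[ L ] (length L ≤ suc (count st P) ×
               All (λ X → length X ≤ 3) L × (∀ {j} → j ∈ P → Any (λ X → Screens P st X j) L))
  separators (root x) st with st x in eq
  ... | nothing = [ [ x ] ] , ≤-refl , s≤s z≤n ∷ [] ,
                  λ { (here refl) → here λ { (here refl) eq′ → contradiction (trans (sym eq) eq′) λ () } }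
  ... | just y  = [ [ y ] ] , s≤s z≤n , s≤s z≤n ∷ [] ,
                  λ { (here refl) → here λ { (here refl) eq′ → inj₁ (here (just-injective (trans (sym eq′) eq))) } }
  separators {i ∷ P} (leaf {p = p} o i∉P p∈P ip nb) st = byMark (st i) (st p) refl refl
    where
    keep : ∀ {u} → u ∈ P → Retracts T i p u u
    keep u∈P = inj₂ (∉⇒≢ T i∉P u∈P , refl)
    pull : Retracts T i p i p
    pull = inj₁ (refl , refl)
    ≢i : ∀ {j} → j ∈ P → j ≢ i
    ≢i = ∉⇒≢ T i∉P

    inside-inside : ∀ {X k j} → k ∈ P → j ∈ P → Separates P X k j → Separates (i ∷ P) X k j
    inside-inside k∈P j∈P = separates-leaf p∈P nb (keep k∈P) (keep j∈P) (inj₁ (≢i k∈P))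
    inside-leaf : ∀ {X k} → k ∈ P → Separates P X k p → Separates (i ∷ P) X k i
    inside-leaf k∈P = separates-leaf p∈P nb (keep k∈P) pull (inj₁ (≢i k∈P))
    leaf-inside : ∀ {X j} → j ∈ P → Separates P X p j → Separates (i ∷ P) X i j
    leaf-inside j∈P = separates-leaf p∈P nb pull (keep j∈P) (inj₂ (≢i j∈P))

    Result : Set
    Result = ∃[ L ] (length L ≤ suc (count st (i ∷ P)) ×
             All (λ X → length X ≤ 3) L × (∀ {j} → j ∈ i ∷ P → Any (λ X → Screens (i ∷ P) st X j) L))

    byMark : ∀ a b → st i ≡ a → st p ≡ b → Result
    byMark nothing _ sti _ with L , len , sizes , cover ← separators o st =
      L , ≤-trans len (s≤s (m≤n+m _ (weight (st i)))) , sizes , cover′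
      where
      from-P : ∀ {X j} → j ∈ P → Screens P st X j → Screens (i ∷ P) st X j
      from-P j∈P scr (here refl) eq with () ← trans (sym sti) eq
      from-P j∈P scr (there k∈P) eq with scr k∈P eq
      ... | inj₁ y∈X         = inj₁ y∈X
      ... | inj₂ (k≢j , sep) = inj₂ (k≢j , inside-inside k∈P j∈P sep)
      from-p : ∀ {X} → Screens P st X p → Screens (i ∷ P) st X i
      from-p scr (here refl) eq with () ← trans (sym sti) eq
      from-p scr (there k∈P) eq with scr k∈P eq
      ... | inj₁ y∈X       = inj₁ y∈X
      ... | inj₂ (_ , sep) = inj₂ (≢i k∈P , inside-leaf k∈P sep)
      cover′ : ∀ {j} → j ∈ i ∷ P → Any (λ X → Screens (i ∷ P) st X j) L
      cover′ (here refl) = Any.map from-p (cover p∈P)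
      cover′ (there j∈P) = Any.map (from-P j∈P) (cover j∈P)

    byMark (just y) nothing sti stp with L , len , sizes , cover ← separators o (update p y st) =
      L , ≤-trans len (s≤s count-le) , sizes , cover′
      where
      count-le : count (update p y st) P ≤ weight (st i) + count st P
      count-le rewrite sti = count-update st P (leafOrder-unique T o)
      unchanged : ∀ {k z} → st k ≡ just z → update p y st k ≡ just z
      unchanged {k} eq = trans (update-other y st λ { refl → contradiction (trans (sym stp) eq) λ () }) eq
      from-P : ∀ {X j} → j ∈ P → Screens P (update p y st) X j → Screens (i ∷ P) st X j
      from-P j∈P scr (here refl) eq with refl ← trans (sym sti) eq with scr p∈P (update-same p y st)
      ... | inj₁ y∈X       = inj₁ y∈X
      ... | inj₂ (_ , sep) = inj₂ (≢i j∈P ∘ sym , leaf-inside j∈P sep)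
      from-P j∈P scr (there k∈P) eq with scr k∈P (unchanged eq)
      ... | inj₁ y∈X         = inj₁ y∈X
      ... | inj₂ (k≢j , sep) = inj₂ (k≢j , inside-inside k∈P j∈P sep)
      -- The node `j = i` and the mark at `i` both retract to `p`, yet a walk from below `i` to `i`
      -- need not visit `p`. The condition `k ≢ j` in `Screens` excludes the alternative of
      -- separation here, which leaves `y ∈ X`.
      from-p : ∀ {X} → Screens P (update p y st) X p → Screens (i ∷ P) st X i
      from-p scr (here refl) eq with refl ← trans (sym sti) eq with scr p∈P (update-same p y st)
      ... | inj₁ y∈X       = inj₁ y∈X
      ... | inj₂ (p≢p , _) = contradiction refl p≢p
      from-p scr (there k∈P) eq with scr k∈P (unchanged eq)
      ... | inj₁ y∈X       = inj₁ y∈X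
      ... | inj₂ (_ , sep) = inj₂ (≢i k∈P , inside-leaf k∈P sep)
      cover′ : ∀ {j} → j ∈ i ∷ P → Any (λ X → Screens (i ∷ P) st X j) L
      cover′ (here refl) = Any.map from-p (cover p∈P)
      cover′ (there j∈P) = Any.map (from-P j∈P) (cover j∈P)

    byMark (just y) (just z) sti stp with L , len , sizes , cover ← separators o (update p p st) =
      X₀ ∷ L , s≤s (≤-trans len count-le) , ≤-refl ∷ sizes , cover′
      where
      X₀ : List (Fin m)
      -- The node `p` blocks every walk from `P` to `i` or `p`; the gates `y` and `z` answer for the
      -- marks at `i` and at `p` themselves.
      X₀ = p ∷ y ∷ z ∷ []
      count-le : suc (count (update p p st) P) ≤ weight (st i) + count st P
      count-le rewrite sti = s≤s (count-update-just st P stp)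
      through-p : ∀ {k} → Separates P X₀ k p
      through-p w _ = lose (end∈ T w) (here refl)
      at-i : Screens (i ∷ P) st X₀ i
      at-i (here refl) eq with refl ← trans (sym sti) eq = inj₁ (there (here refl))
      at-i (there k∈P) eq = inj₂ (≢i k∈P , inside-leaf k∈P through-p)
      at-p : Screens (i ∷ P) st X₀ p
      at-p (here refl) eq with refl ← trans (sym sti) eq = inj₁ (there (here refl))
      at-p {k} (there k∈P) eq with k ≟ p
      ... | yes refl with refl ← trans (sym stp) eq = inj₁ (there (there (here refl)))
      ... | no k≢p = inj₂ (k≢p , inside-inside k∈P p∈P through-p)
      from-P : ∀ {X j} → j ∈ P → j ≢ p → Screens P (update p p st) X j → Screens (i ∷ P) st X j
      from-P {X} {j} j∈P j≢p scr = go
        where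
        -- The new mark at `p` has gate `p`, so either alternative of `Screens` makes `X` meet all
        -- walks from `p` to `j`. This covers both of the marks that were merged.
        sep-p : Separates P X p j
        sep-p with scr p∈P (update-same p p st)
        ... | inj₁ p∈X       = λ w _ → lose (start∈ T w) p∈X
        ... | inj₂ (_ , sep) = sep
        go : Screens (i ∷ P) st X j
        go (here refl) eq = inj₂ (≢i j∈P ∘ sym , leaf-inside j∈P sep-p)
        go {k} (there k∈P) eq with k ≟ p
        ... | yes refl = inj₂ (j≢p ∘ sym , inside-inside p∈P j∈P sep-p)
        ... | no k≢p with scr k∈P (trans (update-other p st k≢p) eq)
        ...   | inj₁ y∈X         = inj₁ y∈X
        ...   | inj₂ (k≢j , sep) = inj₂ (k≢j , inside-inside k∈P j∈P sep)
      cover′ : ∀ {j} → j ∈ i ∷ P → Any (λ X → Screens (i ∷ P) st X j) (X₀ ∷ L)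
      cover′ (here refl) = here at-i
      cover′ {j} (there j∈P) with j ≟ p
      ... | yes refl = here at-p
      ... | no j≢p   = there (Any.map (from-P j∈P j≢p) (cover j∈P))

  tree-separators : IsTree T → (M : List (Fin m)) → ∃[ L ] (length L ≤ suc (length M) ×
    All (λ X → length X ≤ 3) L ×
    ∀ j → Any (λ X → ∀ {k} → k ∈ M → (w : Walk T k j) → Any (_∈ X) (vertices T w)) L)
  tree-separators tree M
    with P , o , all ← leafOrder T tree
    with L , len , sizes , cover ← separators o (mark M) =
    L , ≤-trans len (s≤s (count-mark M (leafOrder-unique T o))) , sizes ,
    λ j → Any.map (λ {X} → screen {X} {j}) (cover (all j))
    where
    screen : ∀ {X j} → Screens P (mark M) X j →
             ∀ {k} → k ∈ M → (w : Walk T k j) → Any (_∈ X) (vertices T w)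
    screen scr k∈M w with scr (all _) (mark-∈ k∈M)
    ... | inj₁ k∈X       = lose (start∈ T w) k∈X
    ... | inj₂ (_ , sep) = sep w (All.universal all _)

-- From separators in the tree to guards in the graph

elements : ∀ {n} → Subset n → List (Fin n)
elements []            = []
elements (inside  ∷ p) = zero ∷ map suc (elements p)
elements (outside ∷ p) = map suc (elements p)

length-elements : ∀ {n} (p : Subset n) → length (elements p) ≡ ∣ p ∣
length-elements []            = refl
length-elements (inside  ∷ p) = cong suc (trans (length-map suc (elements p)) (length-elements p))
length-elements (outside ∷ p) = trans (length-map suc (elements p)) (length-elements p)

∈-elements : ∀ {n x} {p : Subset n} → x Subset.∈ p → x ∈ elements p
∈-elements {p = inside ∷ p}  here        = here refl
∈-elements {p = inside ∷ p}  (there x∈p) = there (∈-map⁺ suc (∈-elements x∈p))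
∈-elements {p = outside ∷ p} (there x∈p) = ∈-map⁺ suc (∈-elements x∈p)

length-concatMap : ∀ {A B : Set} {f : A → List B} {w} → (∀ x → length (f x) ≤ w) →
                   ∀ xs → length (concatMap f xs) ≤ length xs * w
length-concatMap {f = f} f≤ []       = z≤n
length-concatMap {f = f} f≤ (x ∷ xs) =
  ≤-trans (≤-reflexive (length-++ (f x))) (+-mono-≤ (f≤ x) (length-concatMap f≤ xs))

module _ {n} {G : Graph n} (D : TreeDecomposition G) where
  open TreeDecomposition D

  -- Consecutive vertices of the walk share a bag, so their subtrees intersect. Chaining walks
  -- inside these subtrees gives a tree walk on which every bag contains a vertex of the original
  -- walk.
  liftWalk : ∀ {C : Fin n → Set} {u v i j} → WalkIn G C u v → u Subset.∈ bag i → v Subset.∈ bag j →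
             WalkIn tree (λ x → ∃[ y ] (y Subset.∈ bag x × C y)) i j
  liftWalk {u = u} (ε , c ∷ []) u∈i u∈j =
    walkIn-map tree (λ u∈ → u , u∈ , c) (inducesSubtrees u _ _ u∈i u∈j)
  liftWalk {u = u} (e ◅ w , c ∷ cs) u∈i v∈j =
    let k , u∈k , x∈k = coversEdges e in
    walkIn-trans tree (walkIn-map tree (λ u∈ → u , u∈ , c) (inducesSubtrees u _ _ u∈i u∈k))
                      (liftWalk (w , cs) x∈k v∈j)

  home : Fin n → Fin size
  home v = proj₁ (coversVertices v)

  content : List (Fin size) → List (Fin n)
  content = concatMap (elements ∘ bag)

  Guards : Subset n → List (Fin n) → Fin n → Set
  Guards A S v = ∀ a → a Subset.∈ A → (w : Walk G a v) → Any (_∈ S) (vertices G w)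

  -- A walk from `a` to `v` lifts to a tree walk between their home nodes. That walk hits the
  -- separator `X` at some node, and the bag there contains a vertex of the original walk; hence the
  -- union of the at most three bags of `X` is a guard.
  guards : ∀ {b} → (∀ i → ∣ bag i ∣ ≤ b) → (A : Subset n) → ∃[ L ] (length L ≤ suc ∣ A ∣ ×
           All (λ S → length S ≤ 3 * b) L × ∀ v → Any (λ S → Guards A S v) L)
  guards {b} bag≤ A
    with L , len , sizes , cover ← tree-separators tree isTree (map home (elements A)) =
    map content L ,
    ≤-trans (≤-reflexive (length-map content L)) (≤-trans len (s≤s (≤-reflexive
      (trans (length-map home (elements A)) (length-elements A))))) ,
    All.map⁺ (All.map (λ {X} X≤3 → ≤-trans
      (length-concatMap (λ i → ≤-trans (≤-reflexive (length-elements (bag i))) (bag≤ i)) X)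
      (*-monoˡ-≤ b X≤3)) sizes) ,
    λ v → map⁺ (Any.map (λ {X} → guard {X} {v}) (cover (home v)))
    where
    guard : ∀ {X v} → (∀ {k} → k ∈ map home (elements A) → (w : Walk tree k (home v)) →
            Any (_∈ X) (vertices tree w)) → Guards A (content X) v
    guard {X} {v} sep a a∈A w
      -- The predicate carried along is membership in the vertex list of `w` itself.
      with w′ , ws′ ← liftWalk (w , All.tabulate id) (proj₂ (coversVertices a)) (proj₂ (coversVertices v))
      with x , x∈w′ , x∈X ← find (sep (∈-map⁺ home (∈-elements a∈A)) w′)
      with y , y∈x , y∈w ← All.lookup ws′ x∈w′ =
      lose y∈w (∈-concatMap⁺ (elements ∘ bag) (lose x∈X (∈-elements y∈x)))

-- Sauer–Shelah

module _ {V I : Set} (τ : I → V → Bool) where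

  Agree : List I → V → V → Set
  Agree ts v w = All (λ i → τ i v ≡ τ i w) ts

  agree? : ∀ ts v w → Dec (Agree ts v w)
  agree? ts v w = All.all? (λ i → τ i v Bool.≟ τ i w) ts

  -- Shattering unfolded as a binary tree of successive splits, which suits induction on the tests;
  -- `realise` recovers the form with arbitrary sign patterns.
  Shatters : (V → Set) → List I → Set
  Shatters P []       = ∃ P
  Shatters P (i ∷ is) = Shatters (λ v → P v × τ i v ≡ true) is × Shatters (λ v → P v × τ i v ≡ false) is

  -- Shattering depends only on traces. This allows passing to a larger family as well as replacing
  -- rejected members by their accepted twins.
  shatters-map : ∀ {P Q : V → Set} is → (∀ {v} → P v → ∃[ w ] (Q w × Agree is v w)) →
                 Shatters P is → Shatters Q is
  shatters-map [] f (v , p) = let w , q , _ = f p in w , q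
  shatters-map {P} {Q} (i ∷ is) f (sh₁ , sh₀) = shatters-map is (step true) sh₁ , shatters-map is (step false) sh₀
    where
    step : ∀ b {v} → P v × τ i v ≡ b → ∃[ w ] ((Q w × τ i w ≡ b) × Agree is v w)
    step b (p , eq) with f p
    ... | w , q , eq′ ∷ ag = w , (q , trans (sym eq′) eq) , ag

  realise : ∀ {P : V → Set} is → Shatters P is → (f : Fin (length is) → Bool) →
            ∃[ v ] (P v × ∀ k → τ (lookup is k) v ≡ f k)
  realise [] (v , p) f = v , p , λ ()
  realise (i ∷ is) (sh₁ , sh₀) f with f zero in eq
  ... | true  with v , (p , t) , ts ← realise is sh₁ (f ∘ suc) =
    v , p , λ { zero → trans t (sym eq) ; (suc k) → ts k }
  ... | false with v , (p , t) , ts ← realise is sh₀ (f ∘ suc) =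
    v , p , λ { zero → trans t (sym eq) ; (suc k) → ts k }

length-filter-¬ : ∀ {A : Set} {P : A → Set} (P? : U.Decidable P) xs →
                  length xs ≡ length (filter P? xs) + length (filter (¬? ∘ P?) xs)
length-filter-¬ P? [] = refl
length-filter-¬ P? (x ∷ xs) with P? x
... | yes _ = cong suc (length-filter-¬ P? xs)
... | no  _ = trans (cong suc (length-filter-¬ P? xs)) (sym (+-suc (length (filter P? xs)) _))

allPairs-map-with : ∀ {A : Set} {P : A → Set} {R S : A → A → Set} →
                    (∀ {x y} → P x → P y → R x y → S x y) →
                    ∀ {xs} → All P xs → AllPairs R xs → AllPairs S xs
allPairs-map-with f [] [] = []
allPairs-map-with f (p ∷ ps) (r ∷ rs) =
  All.zipWith (λ (q , r) → f p q r) (ps , r) ∷ allPairs-map-with f ps rs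

-- An upper bound for the sum of the binomial coefficients of `N` over `i` for `i < d`;
-- `shatterBound-step` is Pascal's recursion for it, as an inequality.
shatterBound : ℕ → ℕ → ℕ
shatterBound N zero    = 0
shatterBound N (suc d) = suc N ^ d

shatterBound-step : ∀ N d → shatterBound N (suc d) + shatterBound N d ≤ shatterBound (suc N) (suc d)
shatterBound-step N zero    = ≤-refl
shatterBound-step N (suc d) = begin
  suc N * suc N ^ d + suc N ^ d    ≡⟨ +-comm (suc N * suc N ^ d) _ ⟩
  suc (suc N) * suc N ^ d          ≤⟨ *-monoʳ-≤ (suc (suc N)) (^-monoˡ-≤ d (n≤1+n (suc N))) ⟩
  suc (suc N) * suc (suc N) ^ d    ∎
  where open ≤-Reasoning

module _ {V I : Set} (τ : I → V → Bool) where

  -- The members of F rejected by the test i that have a twin accepted by i (same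
  -- value on all other tests) shatter D only if F shatters i ∷ D.

  sauer-shelah : ∀ ts (F : List V) → AllPairs (λ v w → ¬ Agree τ ts v w) F → ∀ d →
    (∀ {D} → D Sublist.⊆ ts → length D ≡ d → ¬ Shatters τ (_∈ F) D) →
    length F ≤ shatterBound (length ts) d
  sauer-shelah ts [] _ d ¬sh = z≤n
  -- The empty list of tests is shattered by any nonempty family.
  sauer-shelah ts (v ∷ F) _ zero ¬sh = ⊥-elim (¬sh (Sublist.minimum ts) refl (v , here refl))
  sauer-shelah [] (v ∷ []) _ (suc d) ¬sh = ≤-reflexive (sym (^-zeroˡ d))
  sauer-shelah [] (v ∷ w ∷ F) ((¬ag ∷ _) ∷ _) (suc d) ¬sh = contradiction [] ¬ag
  sauer-shelah (i ∷ ts) F@(_ ∷ _) F! (suc d) ¬sh = begin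
    length F                              ≡⟨ length-filter-¬ accepted? F ⟩
    length F₁ + length F₀                 ≡⟨ cong (length F₁ +_) (length-filter-¬ twin? F₀) ⟩
    length F₁ + (length F₂ + length F₃)   ≡⟨ cong (length F₁ +_) (+-comm (length F₂) _) ⟩
    length F₁ + (length F₃ + length F₂)   ≡⟨ +-assoc (length F₁) _ _ ⟨
    length F₁ + length F₃ + length F₂     ≡⟨ cong (_+ length F₂) (length-++ F₁) ⟨
    length (F₁ ++ F₃) + length F₂         ≤⟨ +-mono-≤ traces twins ⟩
    shatterBound (length ts) (suc d) + shatterBound (length ts) d ≤⟨ shatterBound-step (length ts) d ⟩
    shatterBound (suc (length ts)) (suc d) ∎
    where
    open ≤-Reasoning
    accepted? : U.Decidable (λ v → τ i v ≡ true)
    accepted? v = τ i v Bool.≟ true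
    F₁ F₀ : List V
    F₁ = filter accepted? F
    F₀ = filter (¬? ∘ accepted?) F
    twin? : U.Decidable (λ v → Any (Agree τ ts v) F₁)
    twin? v = Any.any? (agree? τ ts v) F₁
    F₂ F₃ : List V
    F₂ = filter twin? F₀
    F₃ = filter (¬? ∘ twin?) F₀
    rejected : ∀ {v} → τ i v ≢ true → τ i v ≡ false
    rejected ne = Bool.¬-not ne
    F₁! : AllPairs (λ v w → ¬ Agree τ ts v w) F₁
    F₁! = allPairs-map-with (λ t t′ ¬ag ag → ¬ag (trans t (sym t′) ∷ ag))
            (all-filter accepted? F) (AllPairs.filter⁺ accepted? F!)
    F₀! : AllPairs (λ v w → ¬ Agree τ ts v w) F₀
    F₀! = allPairs-map-with (λ t t′ ¬ag ag → ¬ag (trans (rejected t) (sym (rejected t′)) ∷ ag))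
            (all-filter (¬? ∘ accepted?) F) (AllPairs.filter⁺ (¬? ∘ accepted?) F!)
    F₀⊆F : ∀ {v} → v ∈ F₀ → v ∈ F
    F₀⊆F = proj₁ ∘ ∈-filter⁻ (¬? ∘ accepted?) {xs = F}
    -- `F₁ ++ F₃` keeps exactly one member for each trace of `F` on `ts`; the repetitions make up
    -- `F₂`.
    traces : length (F₁ ++ F₃) ≤ shatterBound (length ts) (suc d)
    traces = sauer-shelah ts (F₁ ++ F₃)
      (AllPairs.++⁺ F₁! (AllPairs.filter⁺ (¬? ∘ twin?) F₀!)
        (All.tabulate λ v∈F₁ → All.map (λ ¬tw ag → ¬tw (lose v∈F₁ (All.map sym ag)))
          (all-filter (¬? ∘ twin?) F₀)))
      (suc d) λ {D} D⊆ len sh → ¬sh (i Sublist.∷ʳ D⊆) len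
        (shatters-map τ D (λ {v} v∈ → v , sub v∈ , All.universal (λ _ → refl) D) sh)
      where
      sub : ∀ {v} → v ∈ F₁ ++ F₃ → v ∈ F
      sub v∈ with ∈-++⁻ F₁ v∈
      ... | inj₁ v∈F₁ = proj₁ (∈-filter⁻ accepted? v∈F₁)
      ... | inj₂ v∈F₃ = F₀⊆F (proj₁ (∈-filter⁻ (¬? ∘ twin?) v∈F₃))
    twins : length F₂ ≤ shatterBound (length ts) d
    twins = sauer-shelah ts F₂ (AllPairs.filter⁺ twin? F₀!) d λ {D} D⊆ len sh →
      ¬sh (refl Sublist.∷ D⊆) (cong suc len)
        ( shatters-map τ D (λ v∈F₂ →
            let w , w∈F₁ , ag = find (proj₂ (∈-filter⁻ twin? {xs = F₀} v∈F₂))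
                w∈F , t = ∈-filter⁻ accepted? {xs = F} w∈F₁
            in w , (w∈F , t) , All.tabulate (All.lookup ag ∘ Sublist.lookup D⊆)) sh
        , shatters-map τ D (λ {v} v∈F₂ →
            let v∈F , t = ∈-filter⁻ (¬? ∘ accepted?) {xs = F} (proj₁ (∈-filter⁻ twin? {xs = F₀} v∈F₂))
            in v , (v∈F , rejected t) , All.universal (λ _ → refl) D) sh )

-- Shattered balls and complete minors

-- Ties go to the smallest index, so that every vertex is assigned to one ball only and the cells
-- are disjoint.
FirstMax : ∀ {d} → (Fin (suc d) → ℕ) → Fin (suc d) → Set
FirstMax f k = ∀ l → f l ≤ f k × (l Fin.< k → f l < f k)

firstMax : ∀ {d} (f : Fin (suc d) → ℕ) → ∃ (FirstMax f)
firstMax {zero}  f = zero , λ { zero → ≤-refl , λ () }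
firstMax {suc d} f with firstMax (f ∘ suc)
... | k , k-max with f (suc k) ≤? f zero
...   | yes fk≤f0 = zero , λ { zero → ≤-refl , (λ ()) ; (suc l) → ≤-trans (proj₁ (k-max l)) fk≤f0 , (λ ()) }
...   | no  fk≰f0 = suc k , λ { zero → <⇒≤ (≰⇒> fk≰f0) , (λ _ → ≰⇒> fk≰f0)
                              ; (suc l) → proj₁ (k-max l) , (λ { (s≤s l<k) → proj₂ (k-max l) l<k }) }

firstMax-unique : ∀ {d} {f : Fin (suc d) → ℕ} {k l} → FirstMax f k → FirstMax f l → k ≡ l
firstMax-unique {k = k} {l} k-max l-max with Fin.<-cmp k l
... | tri< k<l _ _ = contradiction (proj₁ (k-max l)) (<⇒≱ (proj₂ (l-max k) k<l))
... | tri≈ _ k≡l _ = k≡l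
... | tri> _ _ l<k = contradiction (proj₁ (l-max k)) (<⇒≱ (proj₂ (k-max l) l<k))

injective⇒≤∣∣ : ∀ {n} d (f : Fin d → Fin n) → (∀ {k l} → f k ≡ f l → k ≡ l) →
                ∀ p → (∀ k → f k Subset.∈ p) → d ≤ ∣ p ∣
injective⇒≤∣∣ zero    f f-inj p f∈p = z≤n
injective⇒≤∣∣ (suc d) f f-inj p f∈p = ≤-trans
  (s≤s (injective⇒≤∣∣ d (f ∘ suc) (Fin.suc-injective ∘ f-inj) (p - f zero)
    (λ k → x∈p∧x≢y⇒x∈p-y (f∈p (suc k)) (λ eq → contradiction (f-inj eq) λ ()))))
  (x∈p⇒∣p-x∣<∣p∣ (f∈p zero))

-- Truncated subtraction makes this 0 exactly outside the ball of radius ρ.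

room : ℕ → Maybe ℕ → ℕ
room ρ nothing  = 0
room ρ (just ℓ) = suc ρ ∸ ℓ

within⇒room : ∀ {ρ ℓ d} → Within ℓ d → suc ρ ∸ ℓ ≤ room ρ d
within⇒room {ρ} (just d≤ℓ) = ∸-monoʳ-≤ (suc ρ) d≤ℓ

module _ {n} (G : Graph n) where

  Ball : Set
  Ball = Fin n × ℕ

  slack : Ball → Fin n → ℕ
  slack (s , ρ) v = room ρ (dist G s v)

  slack-walk : ∀ {s ρ v} (w : Walk G s v) → suc ρ ∸ walkLength G w ≤ slack (s , ρ) v
  slack-walk w = within⇒room (walk⇒dist G w ≤-refl)

  slack-shortest : ∀ {s ρ v} → 0 < slack (s , ρ) v →
    Σ (Walk G s v) λ w → walkLength G w ≤ ρ × slack (s , ρ) v ≤ suc ρ ∸ walkLength G w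
  slack-shortest {s} {ρ} {v} 0<sl with dist G s v in eq
  ... | just ℓ
    with w , w≤ℓ ← dist⇒walk G {s} {v} {ℓ} (subst (Within ℓ) (sym eq) (just ≤-refl)) =
    w , ≤-trans w≤ℓ (s≤s⁻¹ (m∸n≢0⇒n<m (λ z → <⇒≢ 0<sl (sym z)))) , ∸-monoʳ-≤ (suc ρ) w≤ℓ

  slack-lipschitz : ∀ b {v x} → Adj G v x → slack b v ≤ suc (slack b x)
  slack-lipschitz (s , ρ) {v} {x} e with dist G s v in eq
  ... | nothing = z≤n
  ... | just ℓ
    with w , w≤ℓ ← dist⇒walk G {s} {v} {ℓ} (subst (Within ℓ) (sym eq) (just ≤-refl)) = begin
    suc ρ ∸ ℓ             ≤⟨ ∸-suc-≤ (suc ρ) ℓ ⟩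
    suc (suc ρ ∸ suc ℓ)   ≤⟨ s≤s (within⇒room (walk⇒dist G (w ◅◅ (e ◅ ε)) len)) ⟩
    suc (slack (s , ρ) x) ∎
    where
    open ≤-Reasoning
    ∸-suc-≤ : ∀ a b → a ∸ b ≤ suc (a ∸ suc b)
    ∸-suc-≤ zero    zero    = z≤n
    ∸-suc-≤ zero    (suc b) = z≤n
    ∸-suc-≤ (suc a) zero    = ≤-refl
    ∸-suc-≤ (suc a) (suc b) = ∸-suc-≤ a b
    len : walkLength G (w ◅◅ (e ◅ ε)) ≤ suc ℓ
    len = ≤-trans (≤-reflexive (trans (walkLength-◅◅ G w _) (+-comm _ 1))) (s≤s w≤ℓ)

  -- From `v` to `x` no ball gains more slack than `b`, and `b` loses none. The differences are
  -- rearranged into sums to avoid truncated subtraction.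
  Gains : Ball → Fin n → Fin n → Set
  Gains b v x = slack b v ≤ slack b x × ∀ c → slack c x + slack b v ≤ slack c v + slack b x

  gains-refl : ∀ b v → Gains b v v
  gains-refl b v = ≤-refl , λ _ → ≤-refl

  -- Along an edge every slack rises by at most 1, and that of `b` rises by at least 1.
  gains-step : ∀ {b v x y} → Adj G v x → slack b v < slack b x → Gains b x y → Gains b v y
  gains-step {b} {v} {x} {y} e up (x≤y , gains) = ≤-trans (<⇒≤ up) x≤y , λ c → s≤s⁻¹ (begin
    suc (slack c y + slack b v)     ≡⟨ +-suc (slack c y) _ ⟨
    slack c y + suc (slack b v)     ≤⟨ +-monoʳ-≤ (slack c y) up ⟩
    slack c y + slack b x           ≤⟨ gains c ⟩
    slack c x + slack b y           ≤⟨ +-monoˡ-≤ (slack b y) (slack-lipschitz c (adj-sym G e)) ⟩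
    suc (slack c v + slack b y)     ∎)
    where open ≤-Reasoning

  -- The two inequalities say that `w` is a shortest walk to the centre and stays within the radius,
  -- so each of its steps raises the slack of this ball.
  climb : ∀ {s ρ v} (w : Walk G v s) → walkLength G w ≤ ρ → slack (s , ρ) v ≤ suc ρ ∸ walkLength G w →
          All (Gains (s , ρ) v) (vertices G w)
  climb {s} {ρ} ε _ _ = gains-refl (s , ρ) _ ∷ []
  climb {s} {ρ} {v} (_◅_ {j = x} e w) (s≤s {n = ρ′} w≤ρ) sl≤ =
    gains-refl (s , ρ) v ∷ All.map (λ {y} → gains-step {s , ρ} {v} {x} {y} e up) (climb w (m≤n⇒m≤1+n w≤ρ) sl≤′)
    where
    up : slack (s , ρ) v < slack (s , ρ) x
    up = begin-strict
      slack (s , ρ) v          ≤⟨ sl≤ ⟩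
      ρ ∸ walkLength G w       <⟨ ≤-reflexive (sym (+-∸-assoc 1 (m≤n⇒m≤1+n w≤ρ))) ⟩
      suc ρ ∸ walkLength G w   ≡⟨ cong (suc ρ ∸_) (proj₂ (reverseWalk G w)) ⟨
      suc ρ ∸ walkLength G (proj₁ (reverseWalk G w)) ≤⟨ slack-walk (proj₁ (reverseWalk G w)) ⟩
      slack (s , ρ) x          ∎
      where open ≤-Reasoning
    sl≤′ : slack (s , ρ) x ≤ suc ρ ∸ walkLength G w
    sl≤′ = ≤-trans (slack-lipschitz (s , ρ) (adj-sym G e))
      (≤-trans (s≤s sl≤) (≤-reflexive (sym (+-∸-assoc 1 (m≤n⇒m≤1+n w≤ρ)))))

  ascend : ∀ {b v} → 0 < slack b v → WalkIn G (Gains b v) v (proj₁ b)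
  ascend {s , ρ} 0<sl with w , w≤ρ , sl≤ ← slack-shortest {s} {ρ} 0<sl
    with w′ , eq ← reverseWalk G w =
    w′ , climb w′ (subst (_≤ ρ) (sym eq) w≤ρ) (subst (λ ℓ → slack (s , ρ) _ ≤ suc ρ ∸ ℓ) (sym eq) sl≤)

  switch : ∀ {P Q : Fin n → Set} {u v} → (w : Walk G u v) → All (λ x → P x ⊎ Q x) (vertices G w) →
           P u → Q v →
           (∃[ x ] (P x × Q x)) ⊎ (∃[ x ] ∃[ y ] (Adj G x y × P x × Q y))
  switch {u = u} ε _ pu qu = inj₁ (u , pu , qu)
  switch {u = u} (_◅_ {j = x} e w) (_ ∷ ws) pu qv with All.lookup ws (start∈ G w)
  ... | inj₁ px = switch w ws px qv
  ... | inj₂ qx = inj₂ (u , x , e , pu , qx)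

  -- If for all i ≠ j some vertex lies in the balls i and j only, then the cells
  -- of the vertices with largest slack in each ball form a complete minor.

  module Cells {d} (ball : Fin (suc d) → Ball)
    (common : ∀ i j → ∃[ v ] (0 < slack (ball i) v × 0 < slack (ball j) v ×
                              ∀ k → k ≢ i → k ≢ j → slack (ball k) v ≡ 0)) where

    cell : Fin n → Fin (suc d)
    cell x = proj₁ (firstMax (λ k → slack (ball k) x))

    cell-max : ∀ x → FirstMax (λ k → slack (ball k) x) (cell x)
    cell-max x = proj₂ (firstMax (λ k → slack (ball k) x))

    -- Outside all balls every slack is 0 and `cell` defaults to the index `zero`; positivity
    -- removes these vertices.
    InCell : Fin (suc d) → Fin n → Set
    InCell k x = cell x ≡ k × 0 < slack (ball k) x

    inCell? : ∀ k → U.Decidable (InCell k)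
    inCell? k x = cell x ≟ k ×-dec 1 ≤? slack (ball k) x

    centre : Fin (suc d) → Fin n
    centre k = proj₁ (ball k)

    -- The ball `k` leads at `v`, and no other ball gains more on the way to `x`, so its weak and
    -- strict leads persist.
    gains-cell : ∀ {k v x} → InCell k v → Gains (ball k) v x → InCell k x
    gains-cell {k} {v} {x} (refl , pos) (higher , gains) = firstMax-unique (cell-max x) x-max , ≤-trans pos higher
      where
      x-max : FirstMax (λ l → slack (ball l) x) k
      x-max l =
        +-cancelʳ-≤ (slack (ball k) v) _ _ (≤-trans (gains (ball l))
          (≤-trans (+-monoˡ-≤ _ (proj₁ (cell-max v l))) (≤-reflexive (+-comm (slack (ball k) v) _)))) ,
        λ l<k → +-cancelʳ-< (slack (ball k) v) _ _ (≤-<-trans (gains (ball l))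
          (<-≤-trans (+-monoˡ-< (slack (ball k) x) (proj₂ (cell-max v l) l<k)) (≤-reflexive (+-comm (slack (ball k) v) _))))

    cell-connected : ∀ {k x} → InCell k x → WalkIn G (InCell k) x (centre k)
    cell-connected x∈k = walkIn-map G (gains-cell x∈k) (ascend (proj₂ x∈k))

    -- A third ball has slack 0 at `v` and gains at most as much as ball `i`, which starts positive.
    -- At `x` it is thus strictly behind ball `i` and cannot own the cell.
    gains-pair : ∀ {i j v x} → 0 < slack (ball i) v → (∀ k → k ≢ i → k ≢ j → slack (ball k) v ≡ 0) →
                 Gains (ball i) v x → InCell i x ⊎ InCell j x
    gains-pair {i} {j} {v} {x} pos others (higher , gains) with cell x ≟ i | cell x ≟ j
    ... | yes eq | _       = inj₁ (eq , ≤-trans pos higher)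
    ... | no _   | yes eq  = inj₂ (eq , ≤-trans (≤-trans pos higher)
                               (≤-trans (proj₁ (cell-max x i)) (≤-reflexive (cong (λ k → slack (ball k) x) eq))))
    ... | no ≢i  | no ≢j   = contradiction (proj₁ (cell-max x i)) (<⇒≱ (begin-strict
      slack (ball (cell x)) x                     <⟨ m<m+n _ pos ⟩
      slack (ball (cell x)) x + slack (ball i) v  ≤⟨ gains (ball (cell x)) ⟩
      slack (ball (cell x)) v + slack (ball i) x  ≡⟨ cong (_+ slack (ball i) x) (others (cell x) ≢i ≢j) ⟩
      slack (ball i) x                            ∎))
      where open ≤-Reasoning

    -- From a vertex lying in the balls `i` and `j` only, ascend to both centres.
    link : ∀ i j → WalkIn G (λ x → InCell i x ⊎ InCell j x) (centre i) (centre j)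
    link i j with v , posᵢ , posⱼ , others ← common i j =
      walkIn-trans G
        (walkIn-sym G (walkIn-map G (gains-pair posᵢ others) (ascend posᵢ)))
        (walkIn-map G (Sum.swap ∘ gains-pair posⱼ (λ k k≢j k≢i → others k k≢i k≢j)) (ascend posⱼ))

    -- The links towards `j` and `k` put the centre of `i` into cell `i` or `j`, and into cell `i`
    -- or `k`. Cells being disjoint, only cell `i` is left.
    centre-in-cell : ∀ {i j k} → j ≢ k → InCell i (centre i)
    centre-in-cell {i} {j} {k} j≢k
      with w , ws ← link i j | w′ , ws′ ← link i k
      with All.lookup ws (start∈ G w) | All.lookup ws′ (start∈ G w′)
    ... | inj₁ c∈i | _        = c∈i
    ... | inj₂ _   | inj₁ c∈i = c∈i
    ... | inj₂ c∈j | inj₂ c∈k = contradiction (trans (sym (proj₁ c∈j)) (proj₁ c∈k)) j≢k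

    module _ {j k : Fin (suc d)} (j≢k : j ≢ k) (D : TreeDecomposition G) where
      open TreeDecomposition D

      Meets : Fin (suc d) → Fin size → Set
      Meets k i = ∃[ x ] (x Subset.∈ bag i × InCell k x)

      meets? : ∀ k → U.Decidable (Meets k)
      meets? k i = any? (λ x → x ∈? bag i ×-dec inCell? k x)

      centre∈ : ∀ i → InCell i (centre i)
      centre∈ i = centre-in-cell j≢k

      meets-connected : ∀ k {i j} → Meets k i → Meets k j → WalkIn tree (Meets k) i j
      meets-connected k (x , x∈i , x∈k) (y , y∈j , y∈k) =
        liftWalk D (walkIn-trans G (cell-connected x∈k) (walkIn-sym G (cell-connected y∈k))) x∈i y∈j

      meets-touch : ∀ k l → ∃[ i ] (Meets k i × Meets l i)
      meets-touch k l with switch (proj₁ (link k l)) (proj₂ (link k l)) (centre∈ k) (centre∈ l)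
      ... | inj₁ (x , x∈k , x∈l) =
        let i , x∈i = coversVertices x in i , (x , x∈i , x∈k) , (x , x∈i , x∈l)
      ... | inj₂ (x , y , e , x∈k , y∈l) =
        let i , x∈i , y∈i = coversEdges e in i , (x , x∈i , x∈k) , (y , y∈i , y∈l)

      -- The nodes whose bags meet a given cell form a subtree, and touching cells have intersecting
      -- subtrees. The Helly property yields a bag with a vertex from each cell; these are distinct
      -- because the cells are disjoint.
      large-bag : ∃[ i ] (suc d ≤ ∣ bag i ∣)
      large-bag
        with P , o , all ← leafOrder tree isTree
        with i , met ← helly tree o Meets meets?
               (λ k _ _ mu mv → walkIn-map tree (λ m → all _ , m) (meets-connected k mu mv))
               (λ k l → let i , mk , ml = meets-touch k l in i , all i , mk , ml) =
        i , injective⇒≤∣∣ (suc d) (proj₁ ∘ met)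
              (λ {k} {l} eq → trans (sym (proj₁ (proj₂ (proj₂ (met k)))))
                 (trans (cong cell eq) (proj₁ (proj₂ (proj₂ (met l))))))
              (bag i) (λ k → proj₁ (proj₂ (met k)))

-- Counting profiles

positive : ℕ → Bool
positive zero    = false
positive (suc _) = true

positive⇒< : ∀ {x} → positive x ≡ true → 0 < x
positive⇒< {suc x} _ = s≤s z≤n

<⇒positive : ∀ {x} → 0 < x → positive x ≡ true
<⇒positive (s≤s _) = refl

nonpositive⇒≡0 : ∀ {x} → positive x ≡ false → x ≡ 0
nonpositive⇒≡0 {zero} _ = refl

cap-determined : ∀ {r} x y → (∀ {ℓ} → ℓ ≤ r → Within ℓ x → Within ℓ y) →
                 (∀ {ℓ} → ℓ ≤ r → Within ℓ y → Within ℓ x) → Cap r x ≡ Cap r y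
cap-determined nothing nothing f g = refl
cap-determined {r} nothing (just m) f g with m ≤? r
... | no _ = refl
... | yes m≤r with () ← g m≤r (just ≤-refl)
cap-determined {r} (just l) nothing f g with l ≤? r
... | no _ = refl
... | yes l≤r with () ← f l≤r (just ≤-refl)
cap-determined {r} (just l) (just m) f g with l ≤? r | m ≤? r
... | no _    | no _    = refl
... | yes l≤r | no m≰r  with just m≤l ← f l≤r (just ≤-refl) = contradiction (≤-trans m≤l l≤r) m≰r
... | no l≰r  | yes m≤r with just l≤m ← g m≤r (just ≤-refl) = contradiction (≤-trans l≤m m≤r) l≰r
... | yes l≤r | yes m≤r with just m≤l ← f l≤r (just ≤-refl) | just l≤m ← g m≤r (just ≤-refl) =
  cong just (≤-antisym l≤m m≤l)

allPairs-⊆ : ∀ {A : Set} {R : A → A → Set} {xs ys} → xs Sublist.⊆ ys → AllPairs R ys → AllPairs R xs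
allPairs-⊆ Sublist.[]             []       = []
allPairs-⊆ (_ Sublist.∷ʳ τ)       (_ ∷ rs) = allPairs-⊆ τ rs
allPairs-⊆ (refl Sublist.∷ τ)     (r ∷ rs) = Sublist.All-resp-⊆ τ r ∷ allPairs-⊆ τ rs

split-⊎ : ∀ {A : Set} {P Q : A → Set} {xs} → All (λ x → P x ⊎ Q x) xs →
  ∃[ ys ] ∃[ zs ] (ys Sublist.⊆ xs × zs Sublist.⊆ xs × All P ys × All Q zs ×
                   length xs ≡ length ys + length zs)
split-⊎ [] = [] , [] , Sublist.[] , Sublist.[] , [] , [] , refl
split-⊎ {xs = x ∷ _} (inj₁ p ∷ pqs) =
  let ys , zs , σ , τ , ps , qs , eq = split-⊎ pqs in
  x ∷ ys , zs , refl Sublist.∷ σ , x Sublist.∷ʳ τ , p ∷ ps , qs , cong suc eq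
split-⊎ {xs = x ∷ _} (inj₂ q ∷ pqs) =
  let ys , zs , σ , τ , ps , qs , eq = split-⊎ pqs in
  ys , x ∷ zs , x Sublist.∷ʳ σ , refl Sublist.∷ τ , ps , q ∷ qs , trans (cong suc eq) (sym (+-suc (length ys) _))

length-covered : ∀ {A B : Set} {R : A → A → Set} {C : B → A → Set} {b} (L : List B) →
  All (λ S → ∀ xs → AllPairs R xs → All (C S) xs → length xs ≤ b) L →
  ∀ xs → AllPairs R xs → All (λ x → Any (λ S → C S x) L) xs → length xs ≤ length L * b
length-covered [] _ [] _ _ = z≤n
length-covered [] _ (_ ∷ _) _ (() ∷ _)
length-covered (S ∷ L) (bound ∷ bounds) xs xs! covered
  with ys , zs , σ , τ , ps , qs , eq ← split-⊎ (All.map Any.toSum covered) =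
  ≤-trans (≤-reflexive eq) (+-mono-≤ (bound ys (allPairs-⊆ σ xs!) ps)
    (length-covered L bounds zs (allPairs-⊆ τ xs!) qs))

deduplicate-allPairs : ∀ {A : Set} {R : A → A → Set} (R? : Decidable₂ R) xs →
                       AllPairs (λ x y → ¬ R x y) (deduplicate R? xs)
deduplicate-allPairs R? []       = []
deduplicate-allPairs R? (x ∷ xs) =
  all-filter (¬? ∘ R? x) (deduplicate R? xs) ∷ AllPairs.filter⁺ (¬? ∘ R? x) (deduplicate-allPairs R? xs)

-- Chooses a vertex for each listed profile, so that the counting can be done on vertices.
preimages : ∀ {A B : Set} {f : A → B} {ys} → All (λ y → ∃[ x ] y ≡ f x) ys → ∃[ xs ] ys ≡ map f xs
preimages [] = [] , refl
preimages ((x , refl) ∷ ps) with xs , refl ← preimages ps = x ∷ xs , refl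

module _ {n} (G : Graph n) where

  test : Ball G → Fin n → Bool
  test b v = positive (slack G b v)

  slack-positive : ∀ {s ρ v} (w : Walk G s v) → walkLength G w ≤ ρ → 0 < slack G (s , ρ) v
  slack-positive {ρ = ρ} w w≤ρ = ≤-trans (m<n⇒0<n∸m (s≤s w≤ρ)) (slack-walk G w)

  balls : ℕ → List (Fin n) → List (Ball G)
  balls r = concatMap (λ s → map (s ,_) (upTo (suc r)))

  ∈-balls : ∀ {r S s ρ} → s ∈ S → ρ ≤ r → (s , ρ) ∈ balls r S
  ∈-balls s∈S ρ≤r = ∈-concatMap⁺ _ (lose s∈S (∈-map⁺ _ (∈-upTo⁺ (s≤s ρ≤r))))

  length-balls : ∀ r S → length (balls r S) ≤ length S * suc r
  length-balls r S = length-concatMap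
    (λ s → ≤-reflexive (trans (length-map (s ,_) (upTo (suc r))) (length-upTo (suc r)))) S

  module _ (D : TreeDecomposition G) where
    open TreeDecomposition D

    shattered⇒large-bag : ∀ {P d} (bs : List (Ball G)) → length bs ≡ 3 + d → Shatters test P bs →
                          ∃[ i ] (3 + d ≤ ∣ bag i ∣)
    shattered⇒large-bag bs@(_ ∷ _ ∷ _ ∷ bs′) refl sh =
      Cells.large-bag G (lookup bs) common {zero} {suc zero} (λ ()) D
      where
      common : ∀ i j → ∃[ v ] (0 < slack G (lookup bs i) v × 0 < slack G (lookup bs j) v ×
                               ∀ k → k ≢ i → k ≢ j → slack G (lookup bs k) v ≡ 0)
      -- The sign pattern that accepts exactly the balls `i` and `j`.
      common i j with v , _ , eq ← realise test bs sh (λ k → does (k ≟ i ⊎-dec k ≟ j)) =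
        v ,
        positive⇒< (trans (eq i) (dec-true (i ≟ i ⊎-dec i ≟ j) (inj₁ refl))) ,
        positive⇒< (trans (eq j) (dec-true (j ≟ i ⊎-dec j ≟ j) (inj₂ refl))) ,
        λ k k≢i k≢j → nonpositive⇒≡0 (trans (eq k)
          (dec-false (k ≟ i ⊎-dec k ≟ j) Sum.[ k≢i , k≢j ]))

    -- The bound on the width is `1 + t` here, hence bags of at most `2 + t` vertices and no `3 + t`
    -- shattered balls.
    module _ {t} (bag≤ : ∀ i → ∣ bag i ∣ ≤ 2 + t) (r : ℕ) (A : Subset n) where

      profileOf : Fin n → Profile A
      profileOf v = profile G r v A

      -- A walk of length at most `r` from `a` to `v` passes through some `s` in `S`. The remaining
      -- length `ρ` from `s` is at most `r`, so the ball `(s , ρ)` is among the tests; as it accepts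
      -- `v`, it accepts `w`, and the rest of the walk can be redirected to `w` without getting
      -- longer.
      guarded-agree : ∀ {S v w} → Guards D A S v → Guards D A S w →
                      Agree test (balls r S) v w → profileOf v ≗ profileOf w
      guarded-agree {S} {v} {w} gv gw agree (a , a∈A) =
        cap-determined (dist G a v) (dist G a w) (transfer gv agree) (transfer gw (All.map sym agree))
        where
        transfer : ∀ {x y} → Guards D A S x → Agree test (balls r S) x y →
                   ∀ {ℓ} → ℓ ≤ r → Within ℓ (dist G a x) → Within ℓ (dist G a y)
        transfer {x} {y} guard agr {ℓ} ℓ≤r near
          with W , W≤ℓ ← dist⇒walk G near
          with s , s∈W , s∈S ← find (guard a a∈A W)
          with W₁ , W₂ , eq ← splitAt G W s∈W
          with W₃ , W₃≤ , _ ← slack-shortest G {s} {walkLength G W₂} {y} (positive⇒< (trans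
                 (sym (All.lookup agr (∈-balls s∈S (≤-trans (m≤n+m _ (walkLength G W₁))
                   (≤-trans (≤-reflexive eq) (≤-trans W≤ℓ ℓ≤r))))))
                 (<⇒positive (slack-positive W₂ ≤-refl)))) =
          walk⇒dist G (W₁ ◅◅ W₃) (begin
            walkLength G (W₁ ◅◅ W₃)           ≡⟨ walkLength-◅◅ G W₁ W₃ ⟩
            walkLength G W₁ + walkLength G W₃ ≤⟨ +-monoʳ-≤ (walkLength G W₁) W₃≤ ⟩
            walkLength G W₁ + walkLength G W₂ ≡⟨ eq ⟩
            walkLength G W                    ≤⟨ W≤ℓ ⟩
            ℓ                                 ∎)
          where open ≤-Reasoning

      guarded-count : ∀ {S} → length S ≤ 3 * (2 + t) → ∀ vs → AllPairs (λ v w → ¬ profileOf v ≗ profileOf w) vs →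
                      All (Guards D A S) vs → length vs ≤ suc (3 * (2 + t) * suc r) ^ (2 + t)
      guarded-count {S} S≤ vs vs! guarded = begin
        length vs                              ≤⟨ sauer-shelah test (balls r S) vs
                                                    (allPairs-map-with {P = Guards D A S} (λ gv gw ne → ne ∘ guarded-agree gv gw) guarded vs!)
                                                    (3 + t) unshattered ⟩
        suc (length (balls r S)) ^ (2 + t)     ≤⟨ ^-monoˡ-≤ (2 + t) (s≤s (≤-trans (length-balls r S) (*-monoˡ-≤ (suc r) S≤))) ⟩
        suc (3 * (2 + t) * suc r) ^ (2 + t)    ∎
        where
        open ≤-Reasoning
        unshattered : ∀ {bs} → bs Sublist.⊆ balls r S → length bs ≡ 3 + t → ¬ Shatters test (_∈ vs) bs
        unshattered {bs} _ len sh with i , big ← shattered⇒large-bag bs len sh = 1+n≰n (≤-trans big (bag≤ i))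

      profileCount-bound : profileCount G r A ≤ suc ∣ A ∣ * suc (3 * (2 + t) * suc r) ^ (2 + t)
      profileCount-bound
        with vs , eq ← preimages {f = profileOf} {ys = profiles G r A}
               (All.deduplicate⁺ _≗?_ (All.map⁺ (All.universal (λ v → v , refl) (allFin n))))
        with L , L≤ , sizes , cover ← guards D bag≤ A = begin
        profileCount G r A            ≤⟨ length-filter _ (profiles G r A) ⟩
        length (profiles G r A)       ≡⟨ trans (cong length eq) (length-map profileOf vs) ⟩
        length vs                     ≤⟨ length-covered L (All.map guarded-count sizes) vs
                                           (AllPairs.map⁻ (subst (AllPairs (λ p q → ¬ p ≗ q)) eq
                                              (deduplicate-allPairs _≗?_ (map profileOf (allFin n)))))
                                           (All.universal cover vs) ⟩
        length L * suc (3 * (2 + t) * suc r) ^ (2 + t)  ≤⟨ *-monoˡ-≤ _ L≤ ⟩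
        suc ∣ A ∣ * suc (3 * (2 + t) * suc r) ^ (2 + t) ∎
        where open ≤-Reasoning

  bag-size : ∀ {t} (D : TreeDecomposition G) → TreeDecomposition.width D ≤ t →
             ∀ i → ∣ TreeDecomposition.bag D i ∣ ≤ suc t
  bag-size {t} D width≤t i = ≤-trans (All.lookup (xs≤max 0 sizes) (∈-map⁺ (∣_∣ ∘ bag) (∈-allFin i)))
    (≤-trans (m≤n+m∸n _ 1) (s≤s width≤t))
    where
    open TreeDecomposition D
    sizes : List ℕ
    sizes = map (∣_∣ ∘ bag) (allFin size)

-- Arithmetic of the final bound

-- Here `t` and `r` are the predecessors of the actual parameters. The left side expands to
-- `13 + 6t + 6r + 3tr`, so its constant term 13 dominates all coefficients; the added polynomial is
-- the difference.
ball-count-≤ : ∀ t r → suc (3 * (2 + t) * suc (suc r)) ≤ 13 * suc t * suc r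
ball-count-≤ t r = ≤-trans (m≤m+n _ (7 * t + 10 * (t * r) + 7 * r)) (≤-reflexive
  (solve 2 (λ t r →
    con 1 :+ con 3 :* (con 2 :+ t) :* (con 2 :+ r) :+ (con 7 :* t :+ con 10 :* (t :* r) :+ con 7 :* r)
    := con 13 :* (con 1 :+ t) :* (con 1 :+ r)) refl t r))
  where open +-*-Solver

-- 13 ≤ 2⁴ absorbs the constant base when t ≥ 2; for t = 1 it costs the factor 13².

constant-base : ∀ t → (13 * suc t) ^ (2 + t) ≤ 169 * suc t ^ (10 * suc t)
constant-base zero    = ≤-refl
constant-base (suc t) = begin
  (13 * b) ^ (3 + t)       ≤⟨ ^-monoˡ-≤ (3 + t) 13b≤b⁵ ⟩
  (b ^ 5) ^ (3 + t)        ≡⟨ ^-*-assoc b 5 (3 + t) ⟩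
  b ^ (5 * (3 + t))        ≤⟨ ^-monoʳ-≤ b exponents ⟩
  b ^ (10 * b)             ≤⟨ m≤n*m (b ^ (10 * b)) 169 ⟩
  169 * b ^ (10 * b)       ∎
  where
  open ≤-Reasoning
  b : ℕ
  b = 2 + t
  13≤b⁴ : 13 ≤ b ^ 4
  13≤b⁴ = ≤-trans (m≤m+n 13 3) (^-monoˡ-≤ 4 {2} {b} (s≤s (s≤s z≤n)))
  13b≤b⁵ : 13 * b ≤ b ^ 5
  13b≤b⁵ = ≤-trans (*-monoˡ-≤ b 13≤b⁴) (≤-reflexive (*-comm (b ^ 4) b))
  exponents : 5 * (3 + t) ≤ 10 * b
  exponents = ≤-trans (m≤m+n _ (5 + 5 * t)) (≤-reflexive
    (solve 1 (λ t → con 5 :* (con 3 :+ t) :+ (con 5 :+ con 5 :* t) := con 10 :* (con 2 :+ t)) refl t))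
    where open +-*-Solver

*-distribʳ-^ : ∀ e x y → (x * y) ^ e ≡ x ^ e * y ^ e
*-distribʳ-^ zero    x y = refl
*-distribʳ-^ (suc e) x y = trans (cong (x * y *_) (*-distribʳ-^ e x y))
  (solve 4 (λ x y a b → x :* y :* (a :* b) := x :* a :* (y :* b)) refl x y (x ^ e) (y ^ e))
  where open +-*-Solver

total-bound : ∀ t r k → suc (suc k) * suc (3 * (2 + t) * suc (suc r)) ^ (2 + t) ≤
              338 * suc t ^ (10 * suc t) * suc r ^ (suc t + 1) * suc k
total-bound t r k = begin
  suc (suc k) * suc (3 * (2 + t) * suc (suc r)) ^ (2 + t)
    -- The number of guards, one more than the size `suc k` of the set, is at most twice that size.
    -- This factor 2 and the 169 of `constant-base` give 338.
    ≤⟨ *-mono-≤ (s≤s (s≤s (m≤n+m k k))) (^-monoˡ-≤ (2 + t) (ball-count-≤ t r)) ⟩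
  (2 + (k + k)) * (13 * suc t * suc r) ^ (2 + t)
    ≡⟨ cong ((2 + (k + k)) *_) (*-distribʳ-^ (2 + t) (13 * suc t) (suc r)) ⟩
  (2 + (k + k)) * ((13 * suc t) ^ (2 + t) * suc r ^ (2 + t))
    ≤⟨ *-monoʳ-≤ (2 + (k + k)) (*-monoˡ-≤ (suc r ^ (2 + t)) (constant-base t)) ⟩
  (2 + (k + k)) * (169 * X * suc r ^ (2 + t))
    ≡⟨ cong (λ e → (2 + (k + k)) * (169 * X * suc r ^ e)) (+-comm 1 (suc t)) ⟩
  (2 + (k + k)) * (169 * X * suc r ^ (suc t + 1))
    ≡⟨ solve 3 (λ k X Y → (con 2 :+ (k :+ k)) :* (con 169 :* X :* Y) := con 338 :* X :* Y :* (con 1 :+ k))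
         refl k X (suc r ^ (suc t + 1)) ⟩
  338 * X * suc r ^ (suc t + 1) * suc k ∎
  where
  open ≤-Reasoning
  open +-*-Solver
  X : ℕ
  X = suc t ^ (10 * suc t)

theorem6 : ∃[ C ] ∃[ c ] (0 < C × 0 < c ×
    (∀ (t r : ℕ) → 0 < t → 0 < r →
    ∀ {n : ℕ} (G : Graph n) → TreewidthAtMost t G →
    ∀ (k : ℕ) → 1 ≤ k → k ≤ n →
    profileComplexity G r k ≤ C * t ^ (c * t) * r ^ (t + 1) * k))
theorem6 = 338 , 10 , s≤s z≤n , s≤s z≤n , bound
  where
  bound : ∀ (t r : ℕ) → 0 < t → 0 < r →
          ∀ {n : ℕ} (G : Graph n) → TreewidthAtMost t G →
          ∀ (k : ℕ) → 1 ≤ k → k ≤ n →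
          profileComplexity G r k ≤ 338 * t ^ (10 * t) * r ^ (t + 1) * k
  bound (suc t) (suc r) _ _ {n} G (D , width≤t) (suc k) _ _ =
    -- The base value 0 of the maximum is trivially below the bound; the filter on sizes supplies
    -- the cardinality of each `A`.
    max≤v⁺ z≤n (All.map⁺ (All.map (λ {A} ∣A∣≡k → ≤-trans
      (profileCount-bound G D (bag-size G D width≤t) (suc r) A)
      (≤-trans (≤-reflexive (cong (λ a → suc a * suc (3 * (2 + t) * suc (suc r)) ^ (2 + t)) ∣A∣≡k))
               (total-bound t r k)))
      (all-filter (λ A → ∣ A ∣ ≟ℕ suc k) (subsets n))))
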